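{- For all $k,v\in\mathbb{N}$ such that $k\le 2v+1$, $$f_{2v+1,k}=\binom{v+1}{k}+\sum_{j\ge 1}\frac{(k-2j+1)_{j-1}\,(v+j-k+2)_{k-2j}}{j!\,(k-2j-1)!},$$ where $f_{2v+1,k}$ is the number of order ideals of cardinality $k$ of the fence poset $\mathcal{Z}_{2v+1}$, and a summand with $k-2j-1<0$ is read as $0$.
   Context: $\mathbb{N}$ contains $0$. The fence poset $\mathcal{Z}_n$ of order $n$ is the poset on $\{z_1,\dots,z_n\}$ whose cover relations are exactly $z_{2j-1}\triangleleft z_{2j}\triangleright z_{2j+1}$ for all $j\ge1$ (whenever the indices lie in $\{1,\dots,n\}$), so odd-indexed elements are minimal. An order ideal of a poset $P$ is a subset $I\subseteq P$ such that $y\in I$ and $z\le y$ imply $z\in I$. $f_{n,k}$ denotes the number of order ideals of $\mathcal{Z}_n$ with exactly $k$ elements (the $k$-th Whitney number of the distributive lattice of order ideals of $\mathcal{Z}_n$, whose rank function is cardinality). Rising factorial: $(a)_0=1$ and $(a)_m=\prod_{i=0}^{m-1}(a+i)$ for integers $m\ge1$. $\binom{a}{b}=0$ for integers $b>a\ge0$. Convention: $1/(m!)=0$ for negative integers $m$, so a summand with $k-2j-1<0$ is $0$ and the sum effectively runs over $1\le j\le (k-1)/2$. -}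

module Defs where

open import Data.Fin.Base using (Fin; toℕ)
import Data.Fin.Properties as Fin
open import Data.Fin.Subset using (Subset; inside; outside; ∣_∣) renaming (_∈_ to _∈ˢ_)
open import Data.Fin.Subset.Properties using (_∈?_)
open import Data.Integer.Base as ℤ using (ℤ; +_; -[1+_])
import Data.Integer.Properties as ℤ
open import Data.List.Base as List using (List; []; _∷_; _++_; filter; length; applyUpTo)
open import Data.List.Membership.Propositional using (_∈_)
open import Data.List.Membership.Propositional.Properties
  using (∈-map⁺; ∈-map⁻; ∈-++⁺ˡ; ∈-++⁺ʳ)
open import Data.List.Relation.Unary.All using ([])
open import Data.List.Relation.Unary.Any using (here)
open import Data.List.Relation.Unary.AllPairs using ([]; _∷_)
open import Data.List.Relation.Unary.Unique.Propositional using (Unique)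
open import Data.List.Relation.Unary.Unique.Propositional.Properties using (map⁺; ++⁺)
open import Data.Nat.Base as ℕ using (ℕ; zero; suc; _∸_; _!)
open import Data.Nat.Divisibility using (_∣_; _∣?_; ∣m+n∣m⇒∣n; ∣1⇒≡1)
import Data.Nat.Properties as ℕ
open import Data.Product.Base using (_×_; _,_)
open import Data.Rational.Base as ℚ using (ℚ; 0ℚ)
import Data.Rational.Properties as ℚ
open import Data.Sum.Base using (_⊎_; inj₁; inj₂)
open import Data.Vec.Base using ([]; _∷_)
open import Data.Vec.Properties using (∷-injectiveʳ)
open import Level using (0ℓ; _⊔_)
open import Relation.Binary.Bundles using (Poset)
open import Relation.Binary.Construct.Closure.ReflexiveTransitive using (Star; ε; _◅_; _◅◅_)
open import Relation.Binary.PropositionalEquality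
  using (_≡_; refl; sym; trans; cong; subst; isEquivalence)
open import Relation.Nullary using (¬_; Dec; contradiction)
open import Relation.Nullary.Decidable using (_×-dec_; _⊎-dec_; _→-dec_; map′)
open import Relation.Unary using (Pred)

-- The element z_i of the fence is the Fin with index x = i.
index : ∀ {n} → Fin n → ℕ
index x = suc (toℕ x)

-- x ⋖ y: y = z_{2j} and x is z_{2j-1} or z_{2j+1}; j ≥ 1 since index y ≥ 1.
infix 4 _⋖_ _≼_

_⋖_ : ∀ {n} → Fin n → Fin n → Set
x ⋖ y = 2 ∣ index y × (suc (index x) ≡ index y ⊎ index x ≡ suc (index y))

_≼_ : ∀ {n} → Fin n → Fin n → Set
_≼_ = Star _⋖_

_⋖?_ : ∀ {n} (x y : Fin n) → Dec (x ⋖ y)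
x ⋖? y = (2 ∣? index y) ×-dec
  ((suc (index x) ℕ.≟ index y) ⊎-dec (index x ℕ.≟ suc (index y)))

2∣n⇒2∤1+n : ∀ {n} → 2 ∣ n → ¬ 2 ∣ suc n
2∣n⇒2∤1+n {n} 2∣n 2∣1+n
  with () ← ∣1⇒≡1 (∣m+n∣m⇒∣n (subst (2 ∣_) (ℕ.+-comm 1 n) 2∣1+n) 2∣n)

⋖-lower-odd : ∀ {n} {x y : Fin n} → x ⋖ y → ¬ 2 ∣ index x
⋖-lower-odd (2∣y , inj₁ 1+x≡y) 2∣x = 2∣n⇒2∤1+n 2∣x (subst (2 ∣_) (sym 1+x≡y) 2∣y)
⋖-lower-odd (2∣y , inj₂ x≡1+y) 2∣x = 2∣n⇒2∤1+n 2∣y (subst (2 ∣_) x≡1+y 2∣x)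

≼⇒≡⊎⋖ : ∀ {n} {x y : Fin n} → x ≼ y → x ≡ y ⊎ x ⋖ y
≼⇒≡⊎⋖ ε = inj₁ refl
≼⇒≡⊎⋖ (x⋖y ◅ ε) = inj₂ x⋖y
≼⇒≡⊎⋖ ((2∣y , _) ◅ y⋖w ◅ _) = contradiction 2∣y (⋖-lower-odd y⋖w)

≡⊎⋖⇒≼ : ∀ {n} {x y : Fin n} → x ≡ y ⊎ x ⋖ y → x ≼ y
≡⊎⋖⇒≼ (inj₁ refl) = ε
≡⊎⋖⇒≼ (inj₂ x⋖y)  = x⋖y ◅ ε

_≼?_ : ∀ {n} (x y : Fin n) → Dec (x ≼ y)
x ≼? y = map′ ≡⊎⋖⇒≼ ≼⇒≡⊎⋖ ((x Fin.≟ y) ⊎-dec (x ⋖? y))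

≼-antisym : ∀ {n} {x y : Fin n} → x ≼ y → y ≼ x → x ≡ y
≼-antisym x≼y y≼x with ≼⇒≡⊎⋖ x≼y | ≼⇒≡⊎⋖ y≼x
... | inj₁ x≡y | _        = x≡y
... | inj₂ _   | inj₁ y≡x = sym y≡x
... | inj₂ (2∣y , _) | inj₂ y⋖x = contradiction 2∣y (⋖-lower-odd y⋖x)

fence : ℕ → Poset 0ℓ 0ℓ 0ℓ
fence n = record
  { Carrier = Fin n
  ; _≈_ = _≡_
  ; _≤_ = _≼_
  ; isPartialOrder = record
    { isPreorder = record
      { isEquivalence = isEquivalence
      ; reflexive = λ { refl → ε }
      ; trans = _◅◅_
      }
    ; antisym = ≼-antisym
    }
  }

-- Covering: strictly below, with nothing strictly in between.
Covers : ∀ {c ℓ₁ ℓ₂} (P : Poset c ℓ₁ ℓ₂) (x y : Poset.Carrier P) → Set (c ⊔ ℓ₁ ⊔ ℓ₂)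
Covers {ℓ₁ = ℓ₁} {ℓ₂ = ℓ₂} P x y = x < y × (∀ w → ¬ (x < w × w < y))
  where
  open Poset P using (_≈_; _≤_)
  _<_ : Poset.Carrier P → Poset.Carrier P → Set (ℓ₁ ⊔ ℓ₂)
  a < b = a ≤ b × ¬ a ≈ b

⋖⇒covers : ∀ {n} {x y : Fin n} → x ⋖ y → Covers (fence n) x y
⋖⇒covers x⋖y@(2∣y , _) =
  (x⋖y ◅ ε , λ { refl → ⋖-lower-odd x⋖y 2∣y }) , between
  where
  between : ∀ w → _
  between w ((x≼w , x≢w) , (w≼y , w≢y)) with ≼⇒≡⊎⋖ x≼w | ≼⇒≡⊎⋖ w≼y
  ... | inj₁ x≡w | _ = x≢w x≡w
  ... | inj₂ _ | inj₁ w≡y = w≢y w≡y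
  ... | inj₂ (2∣w , _) | inj₂ w⋖y = ⋖-lower-odd w⋖y 2∣w

covers⇒⋖ : ∀ {n} {x y : Fin n} → Covers (fence n) x y → x ⋖ y
covers⇒⋖ ((x≼y , x≢y) , _) with ≼⇒≡⊎⋖ x≼y
... | inj₁ x≡y = contradiction x≡y x≢y
... | inj₂ x⋖y = x⋖y

IsOrderIdeal : ∀ {c ℓ₁ ℓ₂ ℓ} (P : Poset c ℓ₁ ℓ₂) → Pred (Poset.Carrier P) ℓ → Set (c ⊔ ℓ₂ ⊔ ℓ)
IsOrderIdeal P I = ∀ y z → I y → z ≤ y → I z
  where open Poset P using (_≤_)

isOrderIdeal? : ∀ {n} (I : Subset n) → Dec (IsOrderIdeal (fence n) (_∈ˢ I))
isOrderIdeal? I = Fin.all? λ y → Fin.all? λ z →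
  (y ∈? I) →-dec ((z ≼? y) →-dec (z ∈? I))

subsets : ∀ n → List (Subset n)
subsets zero    = [] ∷ []
subsets (suc n) = List.map (outside ∷_) (subsets n) ++ List.map (inside ∷_) (subsets n)

∈-subsets : ∀ {n} (I : Subset n) → I ∈ subsets n
∈-subsets []            = here refl
∈-subsets (outside ∷ I) = ∈-++⁺ˡ (∈-map⁺ (outside ∷_) (∈-subsets I))
∈-subsets {suc n} (inside ∷ I) =
  ∈-++⁺ʳ (List.map (outside ∷_) (subsets n)) (∈-map⁺ (inside ∷_) (∈-subsets I))

subsets-unique : ∀ n → Unique (subsets n)
subsets-unique zero    = [] ∷ []
subsets-unique (suc n) =
  ++⁺ (map⁺ ∷-injectiveʳ (subsets-unique n)) (map⁺ ∷-injectiveʳ (subsets-unique n)) disjoint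
  where
  disjoint : ∀ {I} → ¬ (I ∈ List.map (outside ∷_) (subsets n) ×
                        I ∈ List.map (inside ∷_) (subsets n))
  disjoint (p , q) with ∈-map⁻ (outside ∷_) p | ∈-map⁻ (inside ∷_) q
  ... | _ , _ , refl | _ , _ , ()

f : ℕ → ℕ → ℕ
f n k = length (filter (λ I → isOrderIdeal? I ×-dec (∣ I ∣ ℕ.≟ k)) (subsets n))

-- The base is an integer because v + j - k + 2 can be negative.
risingFactorial : ℤ → ℕ → ℤ
risingFactorial a zero    = + 1
risingFactorial a (suc m) = risingFactorial a m ℤ.* (a ℤ.+ + m)

-- 1/(m!), read as 0 for negative m.
recipFactorial : ℤ → ℚ
recipFactorial (+ m)    = ((+ 1) ℚ./ (m !)) {{m ℕ.!≢0}}
recipFactorial -[1+ _ ] = 0ℚ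

fromℕ : ℕ → ℚ
fromℕ n = (+ n) ℚ./ 1

fromℤ : ℤ → ℚ
fromℤ a = a ℚ./ 1

-- The truncated k ∸ 2j differs from k - 2j only when the last factor is 0.
summand : (v k j : ℕ) → ℚ
summand v k j =
  fromℤ (risingFactorial (+ k ℤ.- + (2 ℕ.* j) ℤ.+ + 1) (j ∸ 1))
  ℚ.* fromℤ (risingFactorial (+ v ℤ.+ + j ℤ.- + k ℤ.+ + 2) (k ∸ 2 ℕ.* j))
  ℚ.* recipFactorial (+ j)
  ℚ.* recipFactorial (+ k ℤ.- + (2 ℕ.* j) ℤ.- + 1)

-- The sum of g j over 1 ≤ j ≤ N.
∑₁ : ℕ → (ℕ → ℚ) → ℚ
∑₁ N g = List.foldr ℚ._+_ 0ℚ (List.map g (applyUpTo suc N))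

recipFactorial-neg : ∀ {a} → a ℤ.< + 0 → recipFactorial a ≡ 0ℚ
recipFactorial-neg { -[1+ _ ]} _ = refl
recipFactorial-neg {+ _} (ℤ.+<+ ())

-- Hence the sum over all j ≥ 1 equals its truncation to 1 ≤ j ≤ k.
summand-vanishes : ∀ v k j → k ℕ.≤ 2 ℕ.* j → summand v k j ≡ 0ℚ
summand-vanishes v k j k≤2j =
  trans (cong (coefficient ℚ.*_) (recipFactorial-neg negative)) (ℚ.*-zeroʳ coefficient)
  where
  coefficient : ℚ
  coefficient =
    fromℤ (risingFactorial (+ k ℤ.- + (2 ℕ.* j) ℤ.+ + 1) (j ∸ 1))
    ℚ.* fromℤ (risingFactorial (+ v ℤ.+ + j ℤ.- + k ℤ.+ + 2) (k ∸ 2 ℕ.* j))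
    ℚ.* recipFactorial (+ j)
  negative : + k ℤ.- + (2 ℕ.* j) ℤ.- + 1 ℤ.< + 0
  negative = ℤ.+-mono-≤-< (ℤ.i≤j⇒i-j≤0 (ℤ.+≤+ k≤2j)) (ℤ.-<+ {0} {0})

{-# OPTIONS --safe #-}
module Submission where

-- Put a_v (b_v) for the size generating function of the ideals of Z_{2v+1} without z₁ (with z₁,
-- not counting z₁ itself). Removing z₁ and z₂ gives a_{v+1} = a_v + x b_v and
-- b_{v+1} = a_{v+1} + x² b_v, while the ideals of Z_{2v+1} themselves are enumerated by a_{v+1}.
-- By Pascal's rule the coefficients of x^k in
--   S_v = Σ_{j,m} C(m+j-1, j) C(v-j, m) x^{2j+m}  and  T_v = Σ_{j,m} C(m+j, j) C(v-j, m) x^{2j+m}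
-- satisfy the same recurrences, so a_{v+1} = S_{v+1}, whose term with m = k - 2j is, for j ≥ 1,
-- the summand of the theorem and, for j = 0, the binomial coefficient C(v+1, k).

open import Defs
open import Algebra.Properties.CommutativeSemigroup using (interchange; xy∙z≈y∙xz; xy∙z≈xz∙y)
open import Data.Fin.Base using (Fin; zero; suc)
open import Data.Fin.Subset using (Subset; inside; outside; ∣_∣) renaming (_∈_ to _∈ˢ_)
open import Data.Integer.Base as ℤ using (ℤ)
import Data.Integer.Properties as ℤ
import Data.Integer.Tactic.RingSolver as ℤ-Solver
open import Data.List.Base using ([]; _∷_; _++_; filter; length; map; foldr; applyUpTo)
open import Data.List.Properties using (filter-++; filter-≐; filter-none; length-++; map-applyUpTo)
open import Data.List.Relation.Unary.All using (universal)
open import Data.Nat.Base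
open import Data.Nat.Combinatorics
  using (_C_; nCk+nC[k+1]≡[n+1]C[k+1]; k>n⇒nCk≡0; nCk≡n!/k![n-k]!; k![n∸k]!∣n!)
open import Data.Nat.Divisibility using (n∣n; ∣m+n∣m⇒∣n; ∣m∣n⇒∣m+n; ∣1⇒≡1)
open import Data.Nat.DivMod using (m/n*n≡m)
open import Data.Nat.Properties
open import Data.Product.Base using (_,_; map₁; map₂)
open import Data.Rational.Base as ℚ using (ℚ; 0ℚ; fromℚᵘ)
import Data.Rational.Properties as ℚ
open import Data.Rational.Unnormalised.Base as ℚᵘ using (mkℚᵘ; *≡*)
import Data.Rational.Unnormalised.Properties as ℚᵘ
open import Data.Sum.Base as Sum using (inj₁; inj₂)
open import Data.Vec.Base using (_∷_; here; there)
open import Function.Base using (_∘_)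
open import Relation.Binary.PropositionalEquality
  using (_≡_; refl; sym; trans; cong; cong₂; subst; subst₂; module ≡-Reasoning)
open import Relation.Nullary using (¬_; yes; no; contradiction)
open import Relation.Nullary.Decidable using (_×-dec_)
open import Relation.Unary using (Pred; Decidable; _≐_)

-- Ideals of the fence

-- Multiplication by x of the generating function with coefficients `g`.
shift : (ℕ → ℕ) → ℕ → ℕ
shift g zero    = 0
shift g (suc k) = g k

shift-cong : ∀ {g h : ℕ → ℕ} → (∀ k → g k ≡ h k) → ∀ k → shift g k ≡ shift h k
shift-cong g≗h zero    = refl
shift-cong g≗h (suc k) = g≗h k

module _ {a b p} {A : Set a} {B : Set b} {P : Pred B p} (P? : Decidable P) (h : A → B) where

  length-filter-map : ∀ xs → length (filter P? (map h xs)) ≡ length (filter (P? ∘ h) xs)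
  length-filter-map []       = refl
  length-filter-map (x ∷ xs) with P? (h x)
  ... | yes _ = cong suc (length-filter-map xs)
  ... | no  _ = length-filter-map xs

Ideal : ∀ {n} → Subset n → Set
Ideal {n} I = IsOrderIdeal (fence n) (_∈ˢ I)

count : ∀ n {p} {P : Pred (Subset n) p} → Decidable P → ℕ
count n P? = length (filter P? (subsets n))

count-≐ : ∀ n {p q} {P : Pred (Subset n) p} {Q : Pred (Subset n) q}
  (P? : Decidable P) (Q? : Decidable Q) → P ≐ Q → count n P? ≡ count n Q?
count-≐ n P? Q? P≐Q = cong length (filter-≐ P? Q? P≐Q (subsets n))

count-none : ∀ n {p} {P : Pred (Subset n) p} (P? : Decidable P) → (∀ I → ¬ P I) → count n P? ≡ 0
count-none n P? ¬P = cong length (filter-none P? (universal ¬P (subsets n)))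

count-∷ : ∀ n {p} {P : Pred (Subset (suc n)) p} (P? : Decidable P) →
  count (suc n) P? ≡ count n (P? ∘ (outside ∷_)) + count n (P? ∘ (inside ∷_))
count-∷ n P? = begin
  length (filter P? (outs ++ ins))                          ≡⟨ cong length (filter-++ P? outs ins) ⟩
  length (filter P? outs ++ filter P? ins)                  ≡⟨ length-++ (filter P? outs) ⟩
  length (filter P? outs) + length (filter P? ins)
    ≡⟨ cong₂ _+_ (length-filter-map P? _ (subsets n)) (length-filter-map P? _ (subsets n)) ⟩
  count n (P? ∘ (outside ∷_)) + count n (P? ∘ (inside ∷_))  ∎
  where
  open ≡-Reasoning
  outs = map (outside ∷_) (subsets n)
  ins  = map (inside ∷_) (subsets n)

-- Order ideals as sets closed under covers

DownClosed : ∀ {n} → Subset n → Set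
DownClosed {n} I = ∀ {x y : Fin n} → x ⋖ y → y ∈ˢ I → x ∈ˢ I

ideal⇒downClosed : ∀ {n} {I : Subset n} → Ideal I → DownClosed I
ideal⇒downClosed ideal {x} {y} x⋖y y∈I = ideal y x y∈I (≡⊎⋖⇒≼ (inj₂ x⋖y))

-- The fence has height one: `z ≼ y` is an equality or a single cover, so closure under covers
-- suffices.
downClosed⇒ideal : ∀ {n} {I : Subset n} → DownClosed I → Ideal I
downClosed⇒ideal closed y z y∈I z≼y with ≼⇒≡⊎⋖ z≼y
... | inj₁ refl = y∈I
... | inj₂ z⋖y  = closed z⋖y y∈I

-- A shift by two keeps the parity of the index; a shift by one would turn the fence upside down.
⋖-suc² : ∀ {n} {x y : Fin n} → x ⋖ y → _⋖_ {2 + n} (suc (suc x)) (suc (suc y))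
⋖-suc² (2∣y , adjacent) =
  ∣m∣n⇒∣m+n (n∣n {2}) 2∣y , Sum.map (cong (2 +_)) (cong (2 +_)) adjacent

⋖-pred² : ∀ {n} {x y : Fin n} → _⋖_ {2 + n} (suc (suc x)) (suc (suc y)) → x ⋖ y
⋖-pred² (2∣y , adjacent) =
  ∣m+n∣m⇒∣n 2∣y (n∣n {2}) , Sum.map (cong (_∸ 2)) (cong (_∸ 2)) adjacent

ideal-tail² : ∀ {n a b} {I : Subset n} → Ideal (a ∷ b ∷ I) → Ideal I
ideal-tail² {a = a} {b} {I} ideal = downClosed⇒ideal λ x⋖y y∈I →
  drop² (ideal⇒downClosed ideal (⋖-suc² x⋖y) (there (there y∈I)))
  where
  drop² : ∀ {x} → suc (suc x) ∈ˢ (a ∷ b ∷ I) → x ∈ˢ I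
  drop² (there (there x∈I)) = x∈I

-- With z₂ absent, z₁ is free and z₃ is not forced, so all conditions left concern the fence from z₃
-- on.
ideal-outside : ∀ {n a} {I : Subset n} → Ideal I → Ideal (a ∷ outside ∷ I)
ideal-outside {n} {a} {I} ideal = downClosed⇒ideal closed
  where
  closed : DownClosed (a ∷ outside ∷ I)
  closed (2∣1 , _) here with () ← ∣1⇒≡1 2∣1
  closed {zero} (_ , inj₁ ()) (there (there _))
  closed {zero} (_ , inj₂ ()) (there (there _))
  -- The index of z₂ is even, so z₂ is never the lower end of a cover.
  closed {suc zero} x⋖y (there (there y∈I)) = contradiction n∣n (⋖-lower-odd x⋖y)
  closed {suc (suc x)} x⋖y (there (there y∈I)) =
    there (there (ideal⇒downClosed ideal (⋖-pred² x⋖y) y∈I))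

-- z₂ requires only z₁ and z₃, both present; every other cover lies in the fence from z₃ on.
ideal-inside : ∀ {n} {I : Subset n} →
  Ideal (inside ∷ I) → Ideal (inside ∷ inside ∷ inside ∷ I)
ideal-inside {n} {I} ideal = downClosed⇒ideal closed
  where
  closed : DownClosed (inside ∷ inside ∷ inside ∷ I)
  closed {zero}           x⋖y y∈ = here
  closed {suc zero}       x⋖y y∈ = there here
  closed {suc (suc zero)} x⋖y y∈ = there (there here)
  closed {suc (suc (suc x))} {zero} (_ , inj₁ ()) y∈
  closed {suc (suc (suc x))} {zero} (_ , inj₂ ()) y∈
  closed {suc (suc (suc x))} {suc zero} (_ , inj₁ ()) y∈
  closed {suc (suc (suc x))} {suc zero} (_ , inj₂ ()) y∈
  closed {suc (suc (suc x))} {suc (suc y)} x⋖y (there (there y∈)) =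
    there (there (ideal⇒downClosed ideal (⋖-pred² x⋖y) y∈))

z₁-below-z₂ : ∀ {n} {I : Subset n} → ¬ Ideal (outside ∷ inside ∷ I)
z₁-below-z₂ {I = I} ideal
  with () ← ideal⇒downClosed {I = outside ∷ inside ∷ I} ideal
              {zero} {suc zero} (n∣n , inj₁ refl) (there here)

z₃-below-z₂ : ∀ {n a} {I : Subset n} → ¬ Ideal (a ∷ inside ∷ outside ∷ I)
z₃-below-z₂ {a = a} {I} ideal
  with there (there ()) ← ideal⇒downClosed {I = a ∷ inside ∷ outside ∷ I} ideal
                            {suc (suc zero)} {suc zero} (n∣n , inj₂ refl) (there here)

-- The ideals of the fence of order 1 + n without z₁, and those with z₁, where z₁ is not
-- counted in the size k.
without with′ : ℕ → ℕ → ℕ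
without n k = count n λ I → isOrderIdeal? (outside ∷ I) ×-dec (∣ I ∣ ≟ k)
with′   n k = count n λ I → isOrderIdeal? (inside ∷ I) ×-dec (∣ I ∣ ≟ k)

count-pred : ∀ n {p} {P : Pred (Subset n) p} (P? : Decidable P) k →
  count n (λ I → P? I ×-dec (suc ∣ I ∣ ≟ k)) ≡
  shift (λ k → count n (λ I → P? I ×-dec (∣ I ∣ ≟ k))) k
count-pred n P? zero    = count-none n (λ I → P? I ×-dec (suc ∣ I ∣ ≟ zero)) λ where _ (_ , ())
count-pred n P? (suc k) = count-≐ n _ _ (map₂ suc-injective , map₂ (cong suc))

f-split : ∀ n k → f (suc n) k ≡ without n k + shift (with′ n) k
f-split n k = trans
  (count-∷ n λ I → isOrderIdeal? I ×-dec (∣ I ∣ ≟ k))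
  (cong (without n k +_) (count-pred n (λ I → isOrderIdeal? (inside ∷ I)) k))

count-z₂-outside : ∀ n a k →
  count (suc n) (λ I → isOrderIdeal? (a ∷ outside ∷ I) ×-dec (∣ I ∣ ≟ k)) ≡ f (suc n) k
count-z₂-outside n a k = count-≐ (suc n) _ _ (map₁ ideal-tail² , map₁ ideal-outside)

-- Without z₁ there is no z₂ either, and the rest is an arbitrary ideal of the fence from z₃ on.
without-step : ∀ n k → without (2 + n) k ≡ f (suc n) k
without-step n k = begin
  without (2 + n) k
    ≡⟨ count-∷ (suc n) (λ I → isOrderIdeal? (outside ∷ I) ×-dec (∣ I ∣ ≟ k)) ⟩
  count (suc n) (λ I → isOrderIdeal? (outside ∷ outside ∷ I) ×-dec (∣ I ∣ ≟ k)) +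
  count (suc n) z₂-inside?
    ≡⟨ cong₂ _+_ (count-z₂-outside n outside k)
         (count-none (suc n) z₂-inside? λ _ (ideal , _) → z₁-below-z₂ ideal) ⟩
  f (suc n) k + 0
    ≡⟨ +-identityʳ _ ⟩
  f (suc n) k ∎
  where
  open ≡-Reasoning
  z₂-inside? = λ I → isOrderIdeal? (outside ∷ inside ∷ I) ×-dec (suc ∣ I ∣ ≟ k)

-- z₂ forces z₃; the shift accounts for z₃, which `with′` leaves uncounted.
count-z₂-inside : ∀ n k →
  count (suc n) (λ I → isOrderIdeal? (inside ∷ inside ∷ I) ×-dec (∣ I ∣ ≟ k)) ≡
  shift (with′ n) k
count-z₂-inside n k = begin
  count (suc n) (λ I → isOrderIdeal? (inside ∷ inside ∷ I) ×-dec (∣ I ∣ ≟ k))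
    ≡⟨ count-∷ n (λ I → isOrderIdeal? (inside ∷ inside ∷ I) ×-dec (∣ I ∣ ≟ k)) ⟩
  count n z₃-outside? +
  count n (λ I → isOrderIdeal? (inside ∷ inside ∷ inside ∷ I) ×-dec (suc ∣ I ∣ ≟ k))
    ≡⟨ cong₂ _+_
         (count-none n z₃-outside? λ _ (ideal , _) → z₃-below-z₂ ideal)
         (count-≐ n _ _ (map₁ ideal-tail² , map₁ ideal-inside)) ⟩
  count n (λ I → isOrderIdeal? (inside ∷ I) ×-dec (suc ∣ I ∣ ≟ k))
    ≡⟨ count-pred n (λ I → isOrderIdeal? (inside ∷ I)) k ⟩
  shift (with′ n) k ∎
  where
  open ≡-Reasoning
  z₃-outside? = λ I → isOrderIdeal? (inside ∷ inside ∷ outside ∷ I) ×-dec (∣ I ∣ ≟ k)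

-- If z₂ is absent, the ideal is arbitrary from z₃ on; if it is present, z₂ and z₃ give one shift
-- each.
with-step : ∀ n k → with′ (2 + n) k ≡ f (suc n) k + shift (shift (with′ n)) k
with-step n k = begin
  with′ (2 + n) k
    ≡⟨ count-∷ (suc n) (λ I → isOrderIdeal? (inside ∷ I) ×-dec (∣ I ∣ ≟ k)) ⟩
  count (suc n) (λ I → isOrderIdeal? (inside ∷ outside ∷ I) ×-dec (∣ I ∣ ≟ k)) +
  count (suc n) (λ I → isOrderIdeal? (inside ∷ inside ∷ I) ×-dec (suc ∣ I ∣ ≟ k))
    ≡⟨ cong₂ _+_ (count-z₂-outside n inside k)
         (trans (count-pred (suc n) (λ I → isOrderIdeal? (inside ∷ inside ∷ I)) k)
                (shift-cong (count-z₂-inside n) k)) ⟩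
  f (suc n) k + shift (shift (with′ n)) k ∎
  where open ≡-Reasoning

-- The closed form

-- diagonal g k = Σ_{2j + m = k} g j m
diagonal : (ℕ → ℕ → ℕ) → ℕ → ℕ
diagonal g zero          = g 0 0
diagonal g (suc zero)    = g 0 1
diagonal g (suc (suc k)) = g 0 (suc (suc k)) + diagonal (g ∘ suc) k

diagonal-cong : ∀ {g h} → (∀ j m → g j m ≡ h j m) → ∀ k → diagonal g k ≡ diagonal h k
diagonal-cong g≗h zero          = g≗h 0 0
diagonal-cong g≗h (suc zero)    = g≗h 0 1
diagonal-cong g≗h (suc (suc k)) = cong₂ _+_ (g≗h 0 _) (diagonal-cong (g≗h ∘ suc) k)

diagonal-0 : ∀ k → diagonal (λ _ _ → 0) k ≡ 0
diagonal-0 zero          = refl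
diagonal-0 (suc zero)    = refl
diagonal-0 (suc (suc k)) = diagonal-0 k

diagonal-+ : ∀ g h k → diagonal (λ j m → g j m + h j m) k ≡ diagonal g k + diagonal h k
diagonal-+ g h zero          = refl
diagonal-+ g h (suc zero)    = refl
diagonal-+ g h (suc (suc k)) = trans
  (cong (g 0 (2 + k) + h 0 (2 + k) +_) (diagonal-+ (g ∘ suc) (h ∘ suc) k))
  (interchange +-commutativeSemigroup (g 0 (2 + k)) (h 0 (2 + k)) _ _)

diagonal-shift : ∀ g k → diagonal (shift ∘ g) k ≡ shift (diagonal g) k
diagonal-shift g zero                = refl
diagonal-shift g (suc zero)          = refl
-- The extra 0 is the entry j = 1, m = 0, which the shift in m vacates.
diagonal-shift g (suc (suc zero))    = +-identityʳ _
diagonal-shift g (suc (suc (suc k))) = cong (g 0 (2 + k) +_) (diagonal-shift (g ∘ suc) (suc k))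

-- Raising j by one moves an entry up by two diagonals, so `delay` acts as x², just as `shift` in m
-- acts as x.
delay : (ℕ → ℕ → ℕ) → ℕ → ℕ → ℕ
delay g zero    m = 0
delay g (suc j) m = g j m

diagonal-delay : ∀ g k → diagonal (delay g) k ≡ shift (shift (diagonal g)) k
diagonal-delay g zero          = refl
diagonal-delay g (suc zero)    = refl
diagonal-delay g (suc (suc k)) = refl

-- n ∸ j C⁰ m is C(n - j, m), taken to be 0 for j > n; with truncated subtraction it would
-- instead be C(0, m).
_∸_C⁰_ : ℕ → ℕ → ℕ → ℕ
n     ∸ zero  C⁰ m = n C m
zero  ∸ suc j C⁰ m = 0
suc n ∸ suc j C⁰ m = n ∸ j C⁰ m

∸C⁰-pascal : ∀ n j m → suc n ∸ j C⁰ suc m ≡ n ∸ j C⁰ suc m + n ∸ j C⁰ m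
∸C⁰-pascal n       zero          m = trans (sym (nCk+nC[k+1]≡[n+1]C[k+1] n m)) (+-comm (n C m) _)
-- The boundary case j = n + 1 ends here: the left side is C(0, m + 1), which is 0 because the lower
-- index is positive.
∸C⁰-pascal zero    (suc zero)    m = refl
∸C⁰-pascal zero    (suc (suc j)) m = refl
∸C⁰-pascal (suc n) (suc j)       m = ∸C⁰-pascal n j m

-- The first factors count the multisets of size j on m kinds for `S` and on m + 1 kinds for `T`.
-- The case j = 0 of `S` is separate to avoid a subtraction in m + j - 1.
S T : ℕ → ℕ → ℕ → ℕ
S n zero    m = n ∸ 0 C⁰ m
S n (suc j) m = ((m + j) C suc j) * n ∸ suc j C⁰ m
T n j       m = ((m + j) C j) * n ∸ j C⁰ m

-- Pascal's rule in the second factor. The first factor of `S` at m + 1 is that of `T` at m, so the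
-- part with lower index m is an entry of `T`.
S-step : ∀ n j m → S (suc n) j m ≡ S n j m + shift (T n j) m
S-step n zero    zero    = refl
S-step n zero    (suc m) = trans (∸C⁰-pascal n 0 m) (cong (n ∸ 0 C⁰ suc m +_) (sym (+-identityʳ _)))
-- `∸C⁰-pascal` does not reach m = 0, but there the first factor C(j, j + 1) is 0 on both sides.
S-step n (suc j) zero    rewrite k>n⇒nCk≡0 (n<1+n j) = refl
S-step n (suc j) (suc m) = begin
  c * suc n ∸ suc j C⁰ suc m
    ≡⟨ cong (c *_) (∸C⁰-pascal n (suc j) m) ⟩
  c * (n ∸ suc j C⁰ suc m + n ∸ suc j C⁰ m)
    ≡⟨ *-distribˡ-+ c _ _ ⟩
  c * n ∸ suc j C⁰ suc m + c * n ∸ suc j C⁰ m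
    ≡⟨ cong (λ i → S n (suc j) (suc m) + (i C suc j) * n ∸ suc j C⁰ m) (sym (+-suc m j)) ⟩
  S n (suc j) (suc m) + T n (suc j) m ∎
  where
  open ≡-Reasoning
  c = suc (m + j) C suc j

-- Pascal's rule in the first factor. The second factor stays the same, since n and j rise together.
T-step : ∀ n j m → T (suc n) j m ≡ S (suc n) j m + delay (T n) j m
T-step n zero    m = refl
T-step n (suc j) m = begin
  ((m + suc j) C suc j) * w
    ≡⟨ cong (λ i → (i C suc j) * w) (+-suc m j) ⟩
  (suc (m + j) C suc j) * w
    ≡⟨ cong (_* w) (nCk+nC[k+1]≡[n+1]C[k+1] (m + j) j) ⟨
  ((m + j) C j + (m + j) C suc j) * w
    ≡⟨ *-distribʳ-+ w ((m + j) C j) _ ⟩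
  T n j m + S (suc n) (suc j) m
    ≡⟨ +-comm (T n j m) _ ⟩
  S (suc n) (suc j) m + T n j m ∎
  where
  open ≡-Reasoning
  w = n ∸ j C⁰ m

diagonal-S : ∀ n k → diagonal (S (suc n)) k ≡ diagonal (S n) k + shift (diagonal (T n)) k
diagonal-S n k = begin
  diagonal (S (suc n)) k                               ≡⟨ diagonal-cong (S-step n) k ⟩
  diagonal (λ j m → S n j m + shift (T n j) m) k       ≡⟨ diagonal-+ (S n) _ k ⟩
  diagonal (S n) k + diagonal (shift ∘ T n) k          ≡⟨ cong (diagonal (S n) k +_) (diagonal-shift (T n) k) ⟩
  diagonal (S n) k + shift (diagonal (T n)) k          ∎
  where open ≡-Reasoning

diagonal-T : ∀ n k →
  diagonal (T (suc n)) k ≡ diagonal (S (suc n)) k + shift (shift (diagonal (T n))) k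
diagonal-T n k = begin
  diagonal (T (suc n)) k                                     ≡⟨ diagonal-cong (T-step n) k ⟩
  diagonal (λ j m → S (suc n) j m + delay (T n) j m) k       ≡⟨ diagonal-+ (S (suc n)) _ k ⟩
  diagonal (S (suc n)) k + diagonal (delay (T n)) k          ≡⟨ cong (diagonal (S (suc n)) k +_) (diagonal-delay (T n) k) ⟩
  diagonal (S (suc n)) k + shift (shift (diagonal (T n))) k  ∎
  where open ≡-Reasoning

-- Equality of the ideal counts and the closed form, by induction on v

diagonal-suc-0 : ∀ g → (∀ j m → g (suc j) m ≡ 0) → (∀ m → g 0 (suc m) ≡ 0) →
  ∀ k → diagonal g (suc k) ≡ 0
diagonal-suc-0 g g₁ g₀ zero    = g₀ 0
diagonal-suc-0 g g₁ g₀ (suc k) =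
  cong₂ _+_ (g₀ (suc k)) (trans (diagonal-cong g₁ k) (diagonal-0 k))

-- The recursion makes `double (suc v)` unfold to the form `2 + n` of `without-step` and
-- `with-step`.
double : ℕ → ℕ
double zero    = 0
double (suc v) = 2 + double v

double≡2* : ∀ v → double v ≡ 2 * v
double≡2* zero    = refl
double≡2* (suc v) = trans (cong (2 +_) (double≡2* v)) (sym (*-suc 2 v))

mutual
  without≡diagonal-S : ∀ v k → without (double v) k ≡ diagonal (S v) k
  without≡diagonal-S zero    zero    = refl
  -- For v = 0 nothing remains beside z₁, so no positive size occurs; correspondingly `S 0` has only
  -- its constant term.
  without≡diagonal-S zero    (suc k) = sym (diagonal-suc-0 (S 0)
    (λ j m → *-zeroʳ ((m + j) C suc j)) (λ _ → refl) k)
  without≡diagonal-S (suc v) k       = trans (without-step (double v) k) (f≡diagonal-S v k)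

  with≡diagonal-T : ∀ v k → with′ (double v) k ≡ diagonal (T v) k
  with≡diagonal-T zero    zero    = refl
  with≡diagonal-T zero    (suc k) = sym (diagonal-suc-0 (T 0)
    (λ j m → *-zeroʳ ((m + suc j) C suc j)) (λ _ → refl) k)
  with≡diagonal-T (suc v) k       = begin
    with′ (2 + double v) k
      ≡⟨ with-step (double v) k ⟩
    f (suc (double v)) k + shift (shift (with′ (double v))) k
      ≡⟨ cong₂ _+_ (f≡diagonal-S v k) (shift-cong (shift-cong (with≡diagonal-T v)) k) ⟩
    diagonal (S (suc v)) k + shift (shift (diagonal (T v))) k
      ≡⟨ diagonal-T v k ⟨
    diagonal (T (suc v)) k ∎
    where open ≡-Reasoning

  -- The counts at v give this statement at v, which in turn gives both counts at v + 1.
  f≡diagonal-S : ∀ v k → f (suc (double v)) k ≡ diagonal (S (suc v)) k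
  f≡diagonal-S v k = begin
    f (suc (double v)) k
      ≡⟨ f-split (double v) k ⟩
    without (double v) k + shift (with′ (double v)) k
      ≡⟨ cong₂ _+_ (without≡diagonal-S v k) (shift-cong (with≡diagonal-T v) k) ⟩
    diagonal (S v) k + shift (diagonal (T v)) k
      ≡⟨ diagonal-S v k ⟨
    diagonal (S (suc v)) k ∎
    where open ≡-Reasoning

-- Passage to the rational summands

open import Data.Integer.Base using (+_)

fromℚᵘ-homo-+ : ∀ p q → fromℚᵘ (p ℚᵘ.+ q) ≡ fromℚᵘ p ℚ.+ fromℚᵘ q
fromℚᵘ-homo-+ p q = ℚ.toℚᵘ-injective (ℚᵘ.≃-trans (ℚ.toℚᵘ-fromℚᵘ (p ℚᵘ.+ q)) (ℚᵘ.≃-sym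
  (ℚᵘ.≃-trans (ℚ.toℚᵘ-homo-+ (fromℚᵘ p) (fromℚᵘ q))
              (ℚᵘ.+-cong (ℚ.toℚᵘ-fromℚᵘ p) (ℚ.toℚᵘ-fromℚᵘ q)))))

fromℚᵘ-homo-* : ∀ p q → fromℚᵘ (p ℚᵘ.* q) ≡ fromℚᵘ p ℚ.* fromℚᵘ q
fromℚᵘ-homo-* p q = ℚ.toℚᵘ-injective (ℚᵘ.≃-trans (ℚ.toℚᵘ-fromℚᵘ (p ℚᵘ.* q)) (ℚᵘ.≃-sym
  (ℚᵘ.≃-trans (ℚ.toℚᵘ-homo-* (fromℚᵘ p) (fromℚᵘ q))
              (ℚᵘ.*-cong (ℚ.toℚᵘ-fromℚᵘ p) (ℚ.toℚᵘ-fromℚᵘ q)))))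

fromℕ-homo-+ : ∀ a b → fromℕ (a + b) ≡ fromℕ a ℚ.+ fromℕ b
fromℕ-homo-+ a b = trans
  -- Unnormalised addition cross-multiplies, so the numerator appears as a * 1 + b * 1.
  (cong fromℤ (sym (cong₂ ℤ._+_ (ℤ.*-identityʳ (+ a)) (ℤ.*-identityʳ (+ b)))))
  (fromℚᵘ-homo-+ (mkℚᵘ (+ a) 0) (mkℚᵘ (+ b) 0))

-- Unnormalised fractions multiply without cancelling, so the claim becomes a single cross
-- multiplication over the integers.
*-recip-recip≡fromℕ : ∀ x y c a b .{{_ : NonZero a}} .{{_ : NonZero b}} →
  x ℤ.* y ≡ + (c * (a * b)) →
  fromℤ x ℚ.* fromℤ y ℚ.* (+ 1 ℚ./ a) ℚ.* (+ 1 ℚ./ b) ≡ fromℕ c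
*-recip-recip≡fromℕ x y c a@(suc a-1) b@(suc b-1) xy≡cab = begin
  fromℚᵘ X ℚ.* fromℚᵘ Y ℚ.* fromℚᵘ A ℚ.* fromℚᵘ B
    ≡⟨ cong (λ q → q ℚ.* fromℚᵘ A ℚ.* fromℚᵘ B) (fromℚᵘ-homo-* X Y) ⟨
  fromℚᵘ (X ℚᵘ.* Y) ℚ.* fromℚᵘ A ℚ.* fromℚᵘ B
    ≡⟨ cong (ℚ._* fromℚᵘ B) (fromℚᵘ-homo-* (X ℚᵘ.* Y) A) ⟨
  fromℚᵘ (X ℚᵘ.* Y ℚᵘ.* A) ℚ.* fromℚᵘ B
    ≡⟨ fromℚᵘ-homo-* (X ℚᵘ.* Y ℚᵘ.* A) B ⟨
  fromℚᵘ (X ℚᵘ.* Y ℚᵘ.* A ℚᵘ.* B)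
    ≡⟨ ℚ.fromℚᵘ-cong {X ℚᵘ.* Y ℚᵘ.* A ℚᵘ.* B} {mkℚᵘ (+ c) 0} (*≡* cross) ⟩
  fromℕ c ∎
  where
  open ≡-Reasoning
  X = mkℚᵘ x 0
  Y = mkℚᵘ y 0
  A = mkℚᵘ (+ 1) a-1
  B = mkℚᵘ (+ 1) b-1
  cross : x ℤ.* y ℤ.* + 1 ℤ.* + 1 ℤ.* + 1 ≡ + c ℤ.* + (1 * a * b)
  cross = begin
    x ℤ.* y ℤ.* + 1 ℤ.* + 1 ℤ.* + 1 ≡⟨ trans (ℤ.*-identityʳ _) (trans (ℤ.*-identityʳ _) (ℤ.*-identityʳ _)) ⟩
    x ℤ.* y                         ≡⟨ xy≡cab ⟩
    + (c * (a * b))                 ≡⟨ cong (λ a → + (c * (a * b))) (*-identityˡ a) ⟨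
    + (c * (1 * a * b))             ≡⟨ ℤ.pos-* c _ ⟩
    + c ℤ.* + (1 * a * b)           ∎

sumUpTo : ℕ → (ℕ → ℚ) → ℚ
sumUpTo n h = foldr ℚ._+_ 0ℚ (applyUpTo h n)

sumUpTo-0 : ∀ n {h} → (∀ j → h j ≡ 0ℚ) → sumUpTo n h ≡ 0ℚ
sumUpTo-0 zero    h≗0 = refl
sumUpTo-0 (suc n) h≗0 = cong₂ ℚ._+_ (h≗0 0) (sumUpTo-0 n (h≗0 ∘ suc))

-- Each step of `diagonal` splits off j = 0, lowering k by 2 and n by 1, so k < n persists. The
-- surplus terms vanish by the last hypothesis.
fromℕ-diagonal : ∀ g h k n → k < n →
  (∀ j m → double j + m ≡ k → h j ≡ fromℕ (g j m)) →
  (∀ j → k < double j → h j ≡ 0ℚ) →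
  sumUpTo n h ≡ fromℕ (diagonal g k)
fromℕ-diagonal g h zero (suc n) k<n on off = trans
  (cong₂ ℚ._+_ (on 0 0 refl) (sumUpTo-0 n λ j → off (suc j) z<s))
  (ℚ.+-identityʳ _)
fromℕ-diagonal g h (suc zero) (suc n) k<n on off = trans
  (cong₂ ℚ._+_ (on 0 1 refl) (sumUpTo-0 n λ j → off (suc j) (s<s z<s)))
  (ℚ.+-identityʳ _)
fromℕ-diagonal g h (suc (suc k)) (suc n) (s<s k<n) on off = begin
  h 0 ℚ.+ sumUpTo n (h ∘ suc)
    ≡⟨ cong₂ ℚ._+_ (on 0 (2 + k) refl)
         (fromℕ-diagonal (g ∘ suc) (h ∘ suc) k n (<-trans (n<1+n k) k<n)
           (λ j m eq → on (suc j) m (cong (λ i → 2 + i) eq))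
           (λ j k<2j → off (suc j) (s<s (s<s k<2j)))) ⟩
  fromℕ (g 0 (2 + k)) ℚ.+ fromℕ (diagonal (g ∘ suc) k)
    ≡⟨ fromℕ-homo-+ (g 0 (2 + k)) _ ⟨
  fromℕ (diagonal g (2 + k)) ∎
  where open ≡-Reasoning

-- Binomial coefficients and rising factorials through factorials

C-factorial : ∀ a b → ((a + b) C a) * (a ! * b !) ≡ (a + b) !
C-factorial a b = begin
  ((a + b) C a) * (a ! * b !)
    ≡⟨ cong (λ c → ((a + b) C a) * (a ! * c !)) (m+n∸m≡n a b) ⟨
  ((a + b) C a) * (a ! * (a + b ∸ a) !)
    ≡⟨ cong (_* (a ! * (a + b ∸ a) !)) (nCk≡n!/k![n-k]! (m≤m+n a b)) ⟩
  ((a + b) ! / (a ! * (a + b ∸ a) !)) * (a ! * (a + b ∸ a) !)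
    ≡⟨ m/n*n≡m (k![n∸k]!∣n! (m≤m+n a b)) ⟩
  (a + b) ! ∎
  where
  open ≡-Reasoning
  instance _ = a !* (a + b ∸ a) !≢0

-- C(n, k) k! is the falling factorial n (n - 1) ... (n - k + 1), and this splits off its top
-- factor. For k ≤ n, multiplying by (n - k)! turns both sides into (n + 1)!; for k > n both are 0.
C-absorption : ∀ n k → (suc n C suc k) * suc k ! ≡ suc n * ((n C k) * k !)
C-absorption n k with k ≤? n
... | no k≰n rewrite k>n⇒nCk≡0 (≰⇒> k≰n) | k>n⇒nCk≡0 (s<s (≰⇒> k≰n)) = sym (*-zeroʳ n)
... | yes k≤n with b , refl ← m≤n⇒∃[o]m+o≡n k≤n =
  *-cancelʳ-≡ _ _ (b !) (begin
    (suc (k + b) C suc k) * suc k ! * b !    ≡⟨ *-assoc (suc (k + b) C suc k) _ _ ⟩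
    (suc (k + b) C suc k) * (suc k ! * b !)  ≡⟨ C-factorial (suc k) b ⟩
    suc (k + b) * (k + b) !                  ≡⟨ cong (suc (k + b) *_) (C-factorial k b) ⟨
    suc (k + b) * (((k + b) C k) * (k ! * b !)) ≡⟨ cong (suc (k + b) *_) (*-assoc ((k + b) C k) _ _) ⟨
    suc (k + b) * (((k + b) C k) * k ! * b !) ≡⟨ *-assoc (suc (k + b)) (((k + b) C k) * k !) (b !) ⟨
    suc (k + b) * (((k + b) C k) * k !) * b ! ∎)
  where
  open ≡-Reasoning
  instance _ = b !≢0

-- The factors m + 1, ..., m + i are those that (m + i)! has beyond m!.
risingFactorial-quotient : ∀ m i → risingFactorial (+ suc m) i ℤ.* + (m !) ≡ + ((m + i) !)
risingFactorial-quotient m zero    = trans (ℤ.*-identityˡ _) (cong (λ n → + (n !)) (sym (+-identityʳ m)))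
risingFactorial-quotient m (suc i) = begin
  x ℤ.* + (suc m + i) ℤ.* + (m !)     ≡⟨ xy∙z≈y∙xz ℤ.*-commutativeSemigroup x _ _ ⟩
  + (suc m + i) ℤ.* (x ℤ.* + (m !))   ≡⟨ cong (+ (suc m + i) ℤ.*_) (risingFactorial-quotient m i) ⟩
  + (suc m + i) ℤ.* + ((m + i) !)     ≡⟨ ℤ.pos-* (suc m + i) _ ⟨
  + (suc (m + i) !)                   ≡⟨ cong (λ n → + (n !)) (+-suc m i) ⟨
  + ((m + suc i) !)                   ∎
  where
  open ≡-Reasoning
  x = risingFactorial (+ suc m) i

-- The factors are n, n - 1, …, n - m + 1; one of them is 0 when m > n.
risingFactorial-falling : ∀ n m → risingFactorial (+ suc n ℤ.- + m) m ≡ + ((n C m) * m !)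
risingFactorial-falling n       zero    = refl
risingFactorial-falling zero    (suc m) = begin
  x ℤ.* (+ 1 ℤ.- + suc m ℤ.+ + m)  ≡⟨ cong (x ℤ.*_) (last (+ m)) ⟩
  x ℤ.* + 0                        ≡⟨ ℤ.*-zeroʳ x ⟩
  + 0                              ∎
  where
  open ≡-Reasoning
  x = risingFactorial (+ 1 ℤ.- + suc m) m
  last : ∀ m → + 1 ℤ.- (+ 1 ℤ.+ m) ℤ.+ m ≡ + 0
  last = ℤ-Solver.solve-∀
risingFactorial-falling (suc n) (suc m) = begin
  -- Lowering n and m together keeps the base, so only the last factor, n + 1, is split off.
  risingFactorial (+ suc (suc n) ℤ.- + suc m) m ℤ.* (+ suc (suc n) ℤ.- + suc m ℤ.+ + m)
    ≡⟨ cong₂ ℤ._*_ (cong (λ a → risingFactorial a m) (first (+ suc n) (+ m))) (last (+ suc n) (+ m)) ⟩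
  risingFactorial (+ suc n ℤ.- + m) m ℤ.* + suc n
    ≡⟨ cong (ℤ._* + suc n) (risingFactorial-falling n m) ⟩
  + ((n C m) * m !) ℤ.* + suc n
    ≡⟨ ℤ.*-comm (+ ((n C m) * m !)) (+ suc n) ⟩
  + suc n ℤ.* + ((n C m) * m !)
    ≡⟨ ℤ.pos-* (suc n) _ ⟨
  + (suc n * ((n C m) * m !))
    ≡⟨ cong +_ (C-absorption n m) ⟨
  + ((suc n C suc m) * suc m !) ∎
  where
  open ≡-Reasoning
  first : ∀ n m → + 1 ℤ.+ n ℤ.- (+ 1 ℤ.+ m) ≡ n ℤ.- m
  first = ℤ-Solver.solve-∀
  last : ∀ n m → + 1 ℤ.+ n ℤ.- (+ 1 ℤ.+ m) ℤ.+ m ≡ n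
  last = ℤ-Solver.solve-∀

∸C⁰-+ : ∀ j r m → (j + r) ∸ j C⁰ m ≡ r C m
∸C⁰-+ zero    r m = refl
∸C⁰-+ (suc j) r m = ∸C⁰-+ j r m

-- With j = i + 1, m = k - 2j = p + 1 and r = v - j, the rising factorials are (m + j - 1)! / m! and
-- C(r + 1, m) m!. After m! cancels, division by j! (m - 1)! leaves C(m + j - 1, j) C(r + 1, m).
summand≡S-+ : ∀ i p r →
  summand (suc i + r) (2 * suc i + suc p) (suc i) ≡ fromℕ (S (suc (suc i + r)) (suc i) (suc p))
summand≡S-+ i p r = begin
  summand v k j
    ≡⟨ cong₂ ℚ._*_ (cong (ℚ._* recipFactorial (+ j)) (cong₂ (λ a b → fromℤ a ℚ.* fromℤ b)
         (cong (λ a → risingFactorial a i) base₁)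
         (cong₂ risingFactorial base₂ (m+n∸m≡n (2 * j) m))))
         (cong recipFactorial last) ⟩
  fromℤ x ℚ.* fromℤ y ℚ.* recipFactorial (+ j) ℚ.* recipFactorial (+ p)
    ≡⟨ *-recip-recip≡fromℕ x y c (j !) (p !) {{j !≢0}} {{p !≢0}} x*y ⟩
  fromℕ c
    ≡⟨ cong (λ a → fromℕ (((m + i) C j) * a)) (trans (cong (_∸ i C⁰ m) (sym (+-suc i r))) (∸C⁰-+ i (suc r) m)) ⟨
  fromℕ (S (suc v) j m) ∎
  where
  open ≡-Reasoning
  j = suc i
  m = suc p
  v = j + r
  k = 2 * j + m
  x = risingFactorial (+ suc m) i
  y = risingFactorial (+ suc (suc r) ℤ.- + m) m
  c = ((m + i) C j) * (suc r C m)

  base₁ : + k ℤ.- + (2 * j) ℤ.+ + 1 ≡ + suc m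
  base₁ = lemma (+ (2 * j)) (+ m)
    where
    lemma : ∀ a m → a ℤ.+ m ℤ.- a ℤ.+ + 1 ≡ + 1 ℤ.+ m
    lemma = ℤ-Solver.solve-∀

  base₂ : + v ℤ.+ + j ℤ.- + k ℤ.+ + 2 ≡ + suc (suc r) ℤ.- + m
  base₂ = trans
    (cong (λ a → + v ℤ.+ + j ℤ.- (a ℤ.+ + m) ℤ.+ + 2) (cong (λ a → + (j + a)) (+-identityʳ j)))
    (lemma (+ j) (+ r) (+ m))
    where
    lemma : ∀ j r m → j ℤ.+ r ℤ.+ j ℤ.- (j ℤ.+ j ℤ.+ m) ℤ.+ + 2 ≡ + 2 ℤ.+ r ℤ.- m
    lemma = ℤ-Solver.solve-∀

  last : + k ℤ.- + (2 * j) ℤ.- + 1 ≡ + p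
  last = lemma (+ (2 * j)) (+ p)
    where
    lemma : ∀ a p → a ℤ.+ (+ 1 ℤ.+ p) ℤ.- a ℤ.- + 1 ≡ p
    lemma = ℤ-Solver.solve-∀

  -- Both m + i and j + p equal i + p + 1, so `C-factorial` applies to j and p.
  [m+i]! : (m + i) ! ≡ ((m + i) C j) * (j ! * p !)
  [m+i]! = trans (cong (λ n → suc n !) (+-comm p i))
    (trans (sym (C-factorial j p)) (cong (λ n → (suc n C j) * (j ! * p !)) (+-comm i p)))

  x*y : x ℤ.* y ≡ + (c * (j ! * p !))
  x*y = begin
    x ℤ.* y
      ≡⟨ cong (x ℤ.*_) (risingFactorial-falling (suc r) m) ⟩
    x ℤ.* + ((suc r C m) * m !)
      ≡⟨ cong (λ a → x ℤ.* + a) (*-comm (suc r C m) (m !)) ⟩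
    x ℤ.* + (m ! * (suc r C m))
      ≡⟨ cong (x ℤ.*_) (ℤ.pos-* (m !) _) ⟩
    x ℤ.* (+ (m !) ℤ.* + (suc r C m))
      ≡⟨ ℤ.*-assoc x _ _ ⟨
    x ℤ.* + (m !) ℤ.* + (suc r C m)
      ≡⟨ cong (ℤ._* + (suc r C m)) (risingFactorial-quotient m i) ⟩
    + ((m + i) !) ℤ.* + (suc r C m)
      ≡⟨ ℤ.pos-* ((m + i) !) _ ⟨
    + ((m + i) ! * (suc r C m))
      ≡⟨ cong (λ a → + (a * (suc r C m))) [m+i]! ⟩
    + (((m + i) C j) * (j ! * p !) * (suc r C m))
      ≡⟨ cong +_ (xy∙z≈xz∙y *-commutativeSemigroup ((m + i) C j) _ _) ⟩
    + (c * (j ! * p !)) ∎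

summand≡S : ∀ {k v i p} → double (suc i) + suc p ≡ k → suc i ≤ v →
  summand v k (suc i) ≡ fromℕ (S (suc v) (suc i) (suc p))
summand≡S {i = i} {p} refl j≤v with r , refl ← m≤n⇒∃[o]m+o≡n j≤v = trans
  (cong (λ k → summand (suc i + r) (k + suc p) (suc i)) (double≡2* (suc i)))
  (summand≡S-+ i p r)

theorem2p2 : ∀ (k v : ℕ) → k ≤ 2 * v + 1 →
    fromℕ (f (2 * v + 1) k) ≡ fromℕ ((v + 1) C k) ℚ.+ ∑₁ k (λ j → summand v k j)
theorem2p2 k v k≤2v+1 = begin
  fromℕ (f (2 * v + 1) k)
    ≡⟨ cong (λ n → fromℕ (f n k)) (trans (+-comm (2 * v) 1) (cong suc (sym (double≡2* v)))) ⟩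
  fromℕ (f (suc (double v)) k)
    ≡⟨ cong fromℕ (f≡diagonal-S v k) ⟩
  fromℕ (diagonal (S (suc v)) k)
    -- The bound k + 1 gives j = 0, ..., k: the separate binomial coefficient, then the range of
    -- `∑₁ k`.
    ≡⟨ fromℕ-diagonal (S (suc v)) term k (suc k) (n<1+n k) on off ⟨
  fromℕ (suc v C k) ℚ.+ sumUpTo k (term ∘ suc)
    ≡⟨ cong₂ (λ n s → fromℕ (n C k) ℚ.+ foldr ℚ._+_ 0ℚ s)
         (+-comm 1 v) (sym (map-applyUpTo suc (summand v k) k)) ⟩
  fromℕ ((v + 1) C k) ℚ.+ ∑₁ k (summand v k) ∎
  where
  open ≡-Reasoning
  term : ℕ → ℚ
  term zero    = fromℕ (suc v C k)
  term (suc i) = summand v k (suc i)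

  off : ∀ j → k < double j → term j ≡ 0ℚ
  off (suc i) k<2j = summand-vanishes v k (suc i) (subst (k ≤_) (double≡2* (suc i)) (<⇒≤ k<2j))

  on : ∀ j m → double j + m ≡ k → term j ≡ fromℕ (S (suc v) j m)
  on zero    m       refl = refl
  -- For k = 2j the summand is 0 by the convention for 1/(-1)!, and `S` is 0 through its factor C(i,
  -- i + 1).
  on (suc i) zero    2j≡k = trans
    (summand-vanishes v k (suc i) (≤-reflexive
      (trans (sym 2j≡k) (trans (+-identityʳ _) (double≡2* (suc i))))))
    (cong (λ c → fromℕ (c * v ∸ i C⁰ 0)) (sym (k>n⇒nCk≡0 (n<1+n i))))
  -- From 2j + p + 1 = k ≤ 2v + 1 follows 2j ≤ 2v, hence j ≤ v.
  on (suc i) (suc p) 2j+m≡k = summand≡S 2j+m≡k (*-cancelˡ-≤ 2 (≤-trans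
    (≤-trans (≤-reflexive (sym (double≡2* (suc i)))) (m≤m+n _ p))
    (s≤s⁻¹ (subst₂ _≤_ (trans (sym 2j+m≡k) (+-suc _ p)) (+-comm (2 * v) 1) k≤2v+1))))
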